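{- For every graph $G$, $$\mathrm{con}(G) = \mathrm{tw}(L(G)) + 1,$$ where $\mathrm{con}(G)$ is the vertex congestion of $G$.
   Context: Graphs are finite, simple and undirected, and $G$ has at least one vertex. The line graph $L(G)$ has vertex set $E(G)$, two distinct elements being adjacent if and only if the corresponding edges of $G$ share an endpoint. A tree decomposition of a graph $H$ is a (nonempty) tree $T$ together with a collection of subsets of $V(H)$ (bags) indexed by the nodes of $T$ such that: every vertex of $H$ is in at least one bag; for each vertex $v$ of $H$, the nodes whose bags contain $v$ induce a connected subtree of $T$; and for each edge of $H$ some bag contains both its endpoints. Its width is the size of the largest bag minus 1, and the treewidth $\mathrm{tw}(H)$ is the minimum width of a tree decomposition of $H$ (so $\mathrm{tw}(H)=-1$ if $H$ has no vertices). A tree is sub-cubic if its maximum degree is at most 3. An embedding of $G$ is an injective map $\pi$ from $V(G)$ into the set of leaves of a sub-cubic tree $T$. For $vw\in E(G)$ let $P_{vw}$ be the path in $T$ from $\pi(v)$ to $\pi(w)$. The vertex congestion of $\pi$ is $$\max_{u \in V(T)} |\{vw \in E(G) : u \in V(P_{vw})\}|.$$ The vertex congestion $\mathrm{con}(G)$ of $G$ is the minimum vertex congestion over all sub-cubic trees $T$ and all embeddings $\pi$ of $G$ into the leaves of $T$. -}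

module Defs where

open import Data.Fin using (Fin; _<?_)
open import Data.Fin.Properties using (_≟_)
open import Data.Fin.Subset using (Subset; _∈_; ∣_∣)
open import Data.Integer as ℤ using (ℤ; +_; 1ℤ)
open import Data.List using (List; allFin; cartesianProduct; filter; head; last; length; lookup)
open import Data.List.Membership.DecPropositional using (_∈?_)
open import Data.List.Relation.Unary.All using (All)
open import Data.List.Relation.Unary.Linked using (Linked)
open import Data.List.Relation.Unary.Unique.Propositional using (Unique)
open import Data.Maybe using (just)
open import Data.Nat using (ℕ; NonZero; _⊔_; _≤_)
open import Data.Product using (_×_; _,_; proj₁; proj₂; ∃-syntax; Σ-syntax)
open import Data.Sum using (_⊎_; inj₁; inj₂)
open import Data.Vec using (tabulate)
open import Data.Vec.Functional using (foldr)
open import Function using (_∘_)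
open import Function.Definitions using (Injective)
open import Level using (0ℓ)
open import Relation.Binary using (Rel; Decidable; Symmetric)
open import Relation.Binary.PropositionalEquality using (_≡_; _≢_; refl; sym)
open import Relation.Nullary using (¬_; does; ¬?; _×-dec_; _⊎-dec_)
open import Relation.Unary as Unary using (Pred)

max : ∀ {n} → (Fin n → ℕ) → ℕ
max = foldr _⊔_ 0

count : ∀ {n} {P : Pred (Fin n) 0ℓ} → Unary.Decidable P → ℕ
count P? = ∣ tabulate (does ∘ P?) ∣

-- The order may be zero: the line graph of an edgeless graph is empty.
record Graph : Set₁ where
  field
    order      : ℕ
    Adj        : Rel (Fin order) 0ℓ
    adj?       : Decidable Adj
    adj-sym    : Symmetric Adj
    adj-irrefl : ∀ v → ¬ Adj v v

  Vertex : Set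
  Vertex = Fin order

  degree : Vertex → ℕ
  degree v = count (adj? v)

  -- Every edge occurs exactly once, as the pair of its endpoints in
  -- increasing order, so positions in this list represent the edge set.
  edges : List (Vertex × Vertex)
  edges = filter (λ (u , v) → (u <? v) ×-dec adj? u v)
                 (cartesianProduct (allFin order) (allFin order))

  Edge : Set
  Edge = Fin (length edges)

  endpoints : Edge → Vertex × Vertex
  endpoints = lookup edges

  record Path (u v : Vertex) : Set where
    field
      vertices : List Vertex
      starts   : head vertices ≡ just u
      ends     : last vertices ≡ just v
      linked   : Linked Adj vertices
      simple   : Unique vertices

  open Path public

  -- A path on at least three vertices, closed up by an edge.
  record Cycle : Set where
    field
      {first final} : Vertex
      path          : Path first final
      long          : 3 ≤ length (vertices path)
      closed        : Adj final first

  -- The subgraph induced by P is connected (or empty).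
  ConnectedOn : Pred Vertex 0ℓ → Set
  ConnectedOn P = ∀ u v → P u → P v → Σ[ p ∈ Path u v ] All P (vertices p)

  record IsTree : Set where
    field
      nonEmpty  : NonZero order
      connected : ∀ u v → Path u v
      acyclic   : ¬ Cycle

open Graph using (order; Vertex; Edge; edges; endpoints; degree; IsTree; vertices)

module _ (G : Graph) where

  ShareEndpoint : Rel (Edge G) 0ℓ
  ShareEndpoint e f =
    let (a , b) = endpoints G e
        (c , d) = endpoints G f
    in (a ≡ c ⊎ b ≡ d) ⊎ (a ≡ d ⊎ b ≡ c)

  shareEndpoint? : Decidable ShareEndpoint
  shareEndpoint? e f =
    let (a , b) = endpoints G e
        (c , d) = endpoints G f
    in ((a ≟ c) ⊎-dec (b ≟ d)) ⊎-dec ((a ≟ d) ⊎-dec (b ≟ c))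

  shareEndpoint-sym : Symmetric ShareEndpoint
  shareEndpoint-sym (inj₁ (inj₁ p)) = inj₁ (inj₁ (sym p))
  shareEndpoint-sym (inj₁ (inj₂ p)) = inj₁ (inj₂ (sym p))
  shareEndpoint-sym (inj₂ (inj₁ p)) = inj₂ (inj₂ (sym p))
  shareEndpoint-sym (inj₂ (inj₂ p)) = inj₂ (inj₁ (sym p))

  lineGraph : Graph
  lineGraph = record
    { order      = length (edges G)
    ; Adj        = λ e f → e ≢ f × ShareEndpoint e f
    ; adj?       = λ e f → ¬? (e ≟ f) ×-dec shareEndpoint? e f
    ; adj-sym    = λ {e} {f} (e≢f , s) → (e≢f ∘ sym) , shareEndpoint-sym {e} {f} s
    ; adj-irrefl = λ _ (e≢e , _) → e≢e refl
    }

record TreeDecomposition (H : Graph) : Set₁ where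
  field
    tree      : Graph
    isTree    : IsTree tree
    bag       : Vertex tree → Subset (order H)
    covers    : ∀ v → ∃[ t ] v ∈ bag t
    connected : ∀ v → Graph.ConnectedOn tree (λ t → v ∈ bag t)
    edgeInBag : ∀ {v w} → Graph.Adj H v w → ∃[ t ] (v ∈ bag t × w ∈ bag t)

  width : ℤ
  width = + max (λ t → ∣ bag t ∣) ℤ.- 1ℤ

-- "tw(H) = k", with tw as the relation of being the attained minimum.
Treewidth : Graph → ℤ → Set₁
Treewidth H k =
  (Σ[ D ∈ TreeDecomposition H ] TreeDecomposition.width D ≡ k) ×
  (∀ (D : TreeDecomposition H) → k ℤ.≤ TreeDecomposition.width D)

record Embedding (G : Graph) : Set₁ where
  field
    tree      : Graph
    isTree    : IsTree tree
    subcubic  : ∀ u → degree tree u ≤ 3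
    π         : Vertex G → Vertex tree
    injective : Injective _≡_ _≡_ π
    leaf      : ∀ v → degree tree (π v) ≡ 1

  -- The path witnessing connectedness is the only one, by acyclicity.
  pathVertices : Edge G → List (Vertex tree)
  pathVertices e =
    let (v , w) = endpoints G e
    in vertices (IsTree.connected isTree (π v) (π w))

  congestion : ℕ
  congestion = max (λ u → count (λ e → _∈?_ _≟_ u (pathVertices e)))

-- "con(G) = c", likewise.
VertexCongestion : Graph → ℕ → Set₁
VertexCongestion G c =
  (Σ[ E ∈ Embedding G ] Embedding.congestion E ≡ c) ×
  (∀ (E : Embedding G) → c ≤ Embedding.congestion E)

{-# OPTIONS --safe #-}

-- Both numbers equal the least c for which the partition of V(G) into singletons can be merged
-- pairwise into one block, with at most c edges leaving one of the two blocks at every merge; this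
-- condition is decidable, so the minimum exists constructively.
-- Undoing the merges splits the leaves of a tree, which gives an embedding of congestion at most c.
-- The edges whose paths pass through a tree node form the bags of a tree decomposition of L(G).
-- In a tree decomposition of L(G), the edges at a vertex v form a clique and hence share a bag (Helly),
-- where v is placed. Now prune the tree leaf by leaf, merging all blocks at a leaf before they move on
-- to its neighbour: every edge leaving a block stays in the bag of the node at which the block sits.
module Submission where

open import Data.Empty using (⊥; ⊥-elim)
open import Data.Fin using (_<?_; Fin; zero; suc; punchIn; punchOut)
open import Data.Fin.Properties using
  (_≟_; any?; suc-injective; punchInᵢ≢i; punchIn-punchOut; punchOut-punchIn; punchOut-cong; <-irrefl)
open import Data.Fin.Subset using (Subset; _∈_; ∣_∣; _-_; inside; outside) renaming (⊤ to full)
open import Data.Fin.Subset.Properties using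
  (_∈?_; p⊆q⇒∣p∣≤∣q∣; ∣p∣≤n; ∈⊤; x∈p∧x≢y⇒x∈p-y; x∈p⇒p-x⊂p; x∈p⇒∣p-x∣<∣p∣)
open import Data.Integer as ℤ using (+_; _+_; 1ℤ)
import Data.Integer.Properties as ℤₚ
open import Data.List using (List; []; _∷_; last; map; length; allFin; cartesianProduct)
open import Data.List.Properties using (length-map)
open import Data.List.Membership.Propositional using () renaming (_∈_ to _∈ˡ_; _∉_ to _∉ˡ_)
open import Data.List.Membership.Propositional.Properties using (∈-lookup; ∈-filter⁻)
open import Data.List.Membership.DecPropositional using () renaming (_∈?_ to mem?)
open import Data.List.Relation.Unary.All as All using (All; []; _∷_)
open import Data.List.Relation.Unary.All.Properties using (¬Any⇒All¬)
open import Data.List.Relation.Unary.AllPairs using ([]; _∷_)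
open import Data.List.Relation.Unary.Any using (here; there)
open import Data.List.Relation.Unary.Linked using (Linked; []; [-]; _∷_)
import Data.List.Relation.Unary.Linked.Properties as Linked
open import Data.List.Relation.Unary.Unique.Propositional using (Unique)
import Data.List.Relation.Unary.Unique.Propositional.Properties as Unique
open import Data.Maybe using (just)
open import Data.Maybe.Properties using (just-injective)
open import Data.Nat using (ℕ; zero; suc; NonZero; _≤_; z≤n; s≤s)
open import Data.Nat.Properties using (_≤?_; ≤-trans; ≤-reflexive; ≤-pred; ≤-antisym; m≤m⊔n; m≤n⊔m; ⊔-lub)
open import Data.Product using (_×_; _,_; proj₁; proj₂; map₂; ∃-syntax; Σ-syntax; ∃₂)
open import Data.Sum using (_⊎_; inj₁; inj₂; [_,_]′)
open import Data.Unit using (⊤; tt)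
open import Data.Vec using (tabulate; there) renaming (_∷_ to _∷ᵥ_)
open import Data.Vec.Properties using (lookup∘tabulate; lookup⇒[]=; []=⇒lookup)
open import Function using (_∘_; id)
open import Level using (0ℓ)
open import Relation.Binary.Construct.Closure.ReflexiveTransitive as Star using (Star; ε; _◅_; _◅◅_)
open import Relation.Binary.PropositionalEquality using (_≡_; _≢_; refl; sym; trans; cong; subst)
open import Relation.Nullary using (¬_; Dec; yes; no; does; ¬?; _×-dec_; _⊎-dec_)
open import Relation.Nullary.Decidable using (dec-true; dec-false; decidable-stable)
open import Relation.Unary as Unary using (Pred)
open import Defs

-- Counting, maxima and least witnesses.

does⇒ : ∀ {A : Set} (a? : Dec A) → does a? ≡ inside → A
does⇒ (yes a) _ = a
does⇒ (no _) ()

module _ {n} {P : Pred (Fin n) 0ℓ} (P? : Unary.Decidable P) where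

  ∈-tabulate⁺ : ∀ {i} → P i → i ∈ tabulate (does ∘ P?)
  ∈-tabulate⁺ {i} p = lookup⇒[]= i _ (trans (lookup∘tabulate _ i) (dec-true (P? i) p))

  ∈-tabulate⁻ : ∀ {i} → i ∈ tabulate (does ∘ P?) → P i
  ∈-tabulate⁻ {i} i∈ = does⇒ (P? i) (trans (sym (lookup∘tabulate _ i)) ([]=⇒lookup i∈))

  count≤∣_∣ : ∀ S → (∀ {i} → P i → i ∈ S) → count P? ≤ ∣ S ∣
  count≤∣ S ∣ P⊆S = p⊆q⇒∣p∣≤∣q∣ (P⊆S ∘ ∈-tabulate⁻)

count-mono : ∀ {n} {P Q : Pred (Fin n) 0ℓ} (P? : Unary.Decidable P) (Q? : Unary.Decidable Q) →
             (∀ {i} → P i → Q i) → count P? ≤ count Q?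
count-mono P? Q? P⊆Q = count≤∣_∣ P? _ (∈-tabulate⁺ Q? ∘ P⊆Q)

max-upper : ∀ {n} (f : Fin n → ℕ) i → f i ≤ max f
max-upper f zero    = m≤m⊔n (f zero) _
max-upper f (suc i) = ≤-trans (max-upper (f ∘ suc) i) (m≤n⊔m (f zero) _)

max-least : ∀ {n c} (f : Fin n → ℕ) → (∀ i → f i ≤ c) → max f ≤ c
max-least {zero}  f f≤c = z≤n
max-least {suc n} f f≤c = ⊔-lub (f≤c zero) (max-least (f ∘ suc) (f≤c ∘ suc))

-- Upward search from 0, shifting the predicate at each failure; the known witness `n` bounds the
-- number of shifts.
least : ∀ {P : Pred ℕ 0ℓ} → Unary.Decidable P → ∀ {n} → P n → ∃[ m ] (P m × (∀ {k} → P k → m ≤ k))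
least P? {n} p with P? 0
... | yes p₀ = 0 , p₀ , λ _ → z≤n
least P? {zero}  p | no ¬p₀ = ⊥-elim (¬p₀ p)
least {P} P? {suc n} p | no ¬p₀ with least (P? ∘ suc) {n} p
... | m , pm , m≤ = suc m , pm , lower
  where
  lower : ∀ {k} → P k → suc m ≤ k
  lower {zero}  p₀ = ⊥-elim (¬p₀ p₀)
  lower {suc k} pk = s≤s (m≤ pk)

-- Walks, simple paths and leaves on cycles.

module Walks (H : Graph) where
  open Graph H

  On : ∀ {u v} → Pred Vertex 0ℓ → Star Adj u v → Set
  On {u} Q ε       = Q u
  On {u} Q (_ ◅ w) = Q u × On Q w

  trivial : ∀ u → Path u u
  trivial u = record { vertices = u ∷ [] ; starts = refl ; ends = refl ; linked = [-] ; simple = [] ∷ [] }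

  cons : ∀ {u v w} → Adj u w → (p : Path w v) → u ∉ˡ vertices p →
         Σ[ q ∈ Path u v ] vertices q ≡ u ∷ vertices p
  cons a (record { vertices = [] ; starts = () }) u∉
  cons {u} a (record { vertices = x ∷ xs ; starts = refl ; ends = e ; linked = l ; simple = s }) u∉ =
    record { vertices = u ∷ x ∷ xs ; starts = refl ; ends = e ; linked = a ∷ l ; simple = ¬Any⇒All¬ _ u∉ ∷ s } , refl

  suffix : ∀ {xs v w} → last xs ≡ just v → Linked Adj xs → Unique xs → w ∈ˡ xs →
           Σ[ q ∈ Path w v ] (∀ {x} → x ∈ˡ vertices q → x ∈ˡ xs)
  suffix e l s (here refl) =
    record { vertices = _ ; starts = refl ; ends = e ; linked = l ; simple = s } , id
  suffix {_ ∷ _ ∷ _} e (_ ∷ l) (_ ∷ s) (there i) with suffix e l s i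
  ... | q , q⊆ = q , there ∘ q⊆

  prefix : ∀ {x xs w} → Linked Adj (x ∷ xs) → Unique (x ∷ xs) → w ∈ˡ x ∷ xs →
           Σ[ q ∈ Path x w ] (∀ {y} → y ∈ˡ vertices q → y ∈ˡ x ∷ xs)
  prefix l s (here refl) = trivial _ , λ { (here refl) → here refl }
  prefix {x} {y ∷ ys} (a ∷ l) (x∉ ∷ s) (there i) with prefix l s i
  ... | q , q⊆ with cons a q (λ x∈ → All.lookup x∉ (q⊆ x∈) refl)
  ...   | r , eq = r , λ y∈ → split (subst (_ ∈ˡ_) eq y∈)
    where
    split : ∀ {z} → z ∈ˡ x ∷ vertices q → z ∈ˡ x ∷ y ∷ ys
    split (here e)  = here e
    split (there j) = there (q⊆ j)

  -- Loop erasure: if `u` already lies on the path built from the rest, that path is cut to start at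
  -- `u`. The path is chosen before `Q`, so one fixed path can later be confined to every subtree
  -- that contains its ends.
  erase : ∀ {u v} (w : Star Adj u v) →
          Σ[ p ∈ Path u v ] (∀ {Q : Pred Vertex 0ℓ} → On Q w → All Q (vertices p))
  erase {u} ε = trivial u , λ q → q ∷ []
  erase {u} (a ◅ w) with erase w
  ... | p , p-on with mem? _≟_ u (vertices p)
  ...   | yes u∈ with suffix (ends p) (linked p) (simple p) u∈
  ...     | q , q⊆ = q , λ (_ , on) → All.tabulate (All.lookup (p-on on) ∘ q⊆)
  erase {u} (a ◅ w) | p , p-on | no u∉ with cons a p u∉
  ...     | q , eq = q , λ (qu , on) → subst (All _) (sym eq) (qu ∷ p-on on)

  path-nonEmpty : ∀ {u v} (p : Path u v) → u ∈ˡ vertices p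
  path-nonEmpty record { vertices = [] ; starts = () }
  path-nonEmpty record { vertices = _ ∷ _ ; starts = refl } = here refl

  last∈ : ∀ {xs : List Vertex} {v} → last xs ≡ just v → v ∈ˡ xs
  last∈ {x ∷ []}     refl = here refl
  last∈ {x ∷ y ∷ xs} e    = there (last∈ {y ∷ xs} e)

  path-end∈ : ∀ {u v} (p : Path u v) → v ∈ˡ vertices p
  path-end∈ p = last∈ (ends p)

  Restricted : Pred Vertex 0ℓ → Vertex → Vertex → Set
  Restricted Q u v = Adj u v × Q u × Q v

  restricted-sym : ∀ {Q u v} → Restricted Q u v → Restricted Q v u
  restricted-sym (a , q , r) = adj-sym a , r , q

  forget : ∀ {Q u v} → Q u → (w : Star (Restricted Q) u v) → Σ[ w′ ∈ Star Adj u v ] On Q w′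
  forget q ε = ε , q
  forget q ((a , _ , r) ◅ w) with forget r w
  ... | w′ , on = a ◅ w′ , q , on

  list-walk : ∀ {Q x xs y} → Linked Adj (x ∷ xs) → All Q (x ∷ xs) → y ∈ˡ x ∷ xs → Star (Restricted Q) x y
  list-walk l all (here refl) = ε
  list-walk {xs = _ ∷ _} (a ∷ l) (q ∷ r ∷ all) (there i) = (a , q , r) ◅ list-walk l (r ∷ all) i

  -- Both vertices are reached from the start of the path, so a walk through that start joins them
  -- without leaving the path; loop erasure makes it simple.
  path-connectedOn : ∀ {u v} (p : Path u v) → ConnectedOn (_∈ˡ vertices p)
  path-connectedOn record { vertices = [] ; starts = () }
  path-connectedOn record { vertices = x ∷ xs ; linked = l } a b a∈ b∈
    with forget a∈ (Star.reverse restricted-sym (list-walk l (All.tabulate id) a∈) ◅◅ list-walk l (All.tabulate id) b∈)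
  ... | w , on with erase w
  ...   | p , p-on = p , p-on on

  -- An inner occurrence of `t` would have two distinct neighbours on the path, both equal to `t′`.
  -- Being a leaf is relative to `R`, so that the argument survives the pruning of other vertices.
  avoids : ∀ {t t′} {R : Pred Vertex 0ℓ} → (∀ {x} → R x → Adj t x → x ≡ t′) →
           ∀ x xs → Linked Adj (x ∷ xs) → Unique (x ∷ xs) → All R (x ∷ xs) →
           x ≢ t → last (x ∷ xs) ≢ just t → All (_≢ t) (x ∷ xs)
  avoids only x [] l s r x≢t end = x≢t ∷ []
  avoids only x (y ∷ []) l s r x≢t end = x≢t ∷ (end ∘ cong just) ∷ []
  avoids {t} only x (y ∷ z ∷ zs) (a ∷ b ∷ l) ((_ ∷ x≢z ∷ _) ∷ s) (rx ∷ r@(_ ∷ rz ∷ _)) x≢t end with y ≟ t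
  ... | yes refl = ⊥-elim (x≢z (trans (only rx (adj-sym a)) (sym (only rz b))))
  ... | no y≢t   = x≢t ∷ avoids only y (z ∷ zs) (b ∷ l) s r y≢t end

  avoids-path : ∀ {t t′ u v} {R : Pred Vertex 0ℓ} → (∀ {x} → R x → Adj t x → x ≡ t′) →
                (p : Path u v) → All R (vertices p) → u ≢ t → v ≢ t → All (_≢ t) (vertices p)
  avoids-path only record { vertices = [] } r u≢t v≢t = []
  avoids-path only record { vertices = x ∷ xs ; starts = refl ; ends = e ; linked = l ; simple = s } r u≢t v≢t =
    avoids only x xs l s r u≢t (λ e′ → v≢t (just-injective (trans (sym e) e′)))

  predecessor : ∀ {t t′} → (∀ {x} → Adj t x → x ≡ t′) → ∀ x xs → Linked Adj (x ∷ xs) →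
                x ≢ t → last (x ∷ xs) ≡ just t → t′ ∈ˡ x ∷ xs
  predecessor only x [] l x≢t end = ⊥-elim (x≢t (just-injective end))
  predecessor {t} only x (y ∷ ys) (a ∷ l) x≢t end with y ≟ t
  ... | yes refl = here (sym (only (adj-sym a)))
  ... | no y≢t   = there (predecessor only y ys l y≢t end)

  -- Inside the path `avoids-path` applies. At either end the closing edge supplies a second
  -- neighbour, which must equal the neighbour of `t` on the path; that vertex would then occur
  -- twice.
  leaf∉cycle : ∀ {t t′} → (∀ {x} → Adj t x → x ≡ t′) → (C : Cycle) →
               t ∉ˡ vertices (Cycle.path C)
  leaf∉cycle {t} {t′} only C t∈ = All.lookup (avoids-path {R = λ _ → ⊤} (λ _ → only) path (All.tabulate _) first≢t final≢t) t∈ refl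
    where
    open Cycle C
    first≢t : first ≢ t
    first≢t refl with path | long
    ... | record { vertices = _ ∷ _ ∷ [] } | s≤s (s≤s ())
    ... | record { vertices = _ ∷ y ∷ z ∷ zs ; starts = refl ; ends = e ; linked = a ∷ _ ; simple = _ ∷ y∉ ∷ _ } | _ =
      All.lookup y∉ (last∈ {z ∷ zs} e) (trans (only a) (sym (only (adj-sym closed))))
    final≢t : final ≢ t
    final≢t refl with path | long
    ... | record { vertices = _ ∷ _ ∷ [] } | s≤s (s≤s ())
    ... | record { vertices = x ∷ y ∷ z ∷ zs ; starts = refl ; ends = e ; linked = _ ∷ l ; simple = x∉ ∷ y∉ ∷ _ } | _ =
      All.lookup x∉ (predecessor only y (z ∷ zs) l (All.lookup y∉ (last∈ {z ∷ zs} e)) e) (only closed)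

-- Trees grown leaf by leaf, and their subtrees.

infixl 5 _▸_

-- T ▸ p adds a leaf, numbered zero, to the vertex p of T.
data RTree : ℕ → Set where
  root : RTree 1
  _▸_  : ∀ {n} → RTree n → Fin n → RTree (suc n)

TreeAdj : ∀ {n} → RTree n → Fin n → Fin n → Set
TreeAdj root    _       _       = ⊥
TreeAdj (T ▸ p) zero    zero    = ⊥
TreeAdj (T ▸ p) zero    (suc j) = p ≡ j
TreeAdj (T ▸ p) (suc i) zero    = p ≡ i
TreeAdj (T ▸ p) (suc i) (suc j) = TreeAdj T i j

treeAdj? : ∀ {n} (T : RTree n) i j → Dec (TreeAdj T i j)
treeAdj? root    _       _       = no λ ()
treeAdj? (T ▸ p) zero    zero    = no λ ()
treeAdj? (T ▸ p) zero    (suc j) = p ≟ j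
treeAdj? (T ▸ p) (suc i) zero    = p ≟ i
treeAdj? (T ▸ p) (suc i) (suc j) = treeAdj? T i j

treeAdj-sym : ∀ {n} (T : RTree n) i j → TreeAdj T i j → TreeAdj T j i
treeAdj-sym (T ▸ p) zero    (suc j) a = a
treeAdj-sym (T ▸ p) (suc i) zero    a = a
treeAdj-sym (T ▸ p) (suc i) (suc j) a = treeAdj-sym T i j a

treeAdj-irrefl : ∀ {n} (T : RTree n) i → ¬ TreeAdj T i i
treeAdj-irrefl (T ▸ p) (suc i) a = treeAdj-irrefl T i a

graph : ∀ {n} → RTree n → Graph
graph {n} T = record
  { order = n ; Adj = TreeAdj T ; adj? = treeAdj? T
  ; adj-sym = λ {i} {j} → treeAdj-sym T i j ; adj-irrefl = treeAdj-irrefl T }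

degree : ∀ {n} → RTree n → Fin n → ℕ
degree T = Graph.degree (graph T)

∣outside∣ : ∀ n → ∣ tabulate {n = n} (λ _ → outside) ∣ ≡ 0
∣outside∣ zero    = refl
∣outside∣ (suc n) = ∣outside∣ n

count-≟ : ∀ {n} (p : Fin n) → count (p ≟_) ≡ 1
count-≟ {suc n} zero    = cong suc (∣outside∣ n)
count-≟ {suc n} (suc p) = count-≟ p

module _ {n} (T : RTree n) (p : Fin n) where

  degree-new : degree (T ▸ p) zero ≡ 1
  degree-new = count-≟ p

  degree-parent : degree (T ▸ p) (suc p) ≡ suc (degree T p)
  degree-parent rewrite dec-true (p ≟ p) refl = refl

  degree-old : ∀ i → p ≢ i → degree (T ▸ p) (suc i) ≡ degree T i
  degree-old i p≢i rewrite dec-false (p ≟ i) p≢i = refl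

treeWalk : ∀ {n} (T : RTree n) i j → Star (TreeAdj T) i j
treeWalk root    zero    zero    = ε
treeWalk (T ▸ p) zero    zero    = ε
treeWalk (T ▸ p) zero    (suc j) = refl ◅ Star.gmap suc id (treeWalk T p j)
treeWalk (T ▸ p) (suc i) zero    = Star.gmap suc id (treeWalk T i p) ◅◅ refl ◅ ε
treeWalk (T ▸ p) (suc i) (suc j) = Star.gmap suc id (treeWalk T i j)

-- Q induces a subtree (or is empty).
Convex : ∀ {n} → RTree n → Pred (Fin n) 0ℓ → Set
Convex root    Q = ⊤
Convex (T ▸ p) Q = (∀ i → Q zero → Q (suc i) → Q (suc p)) × Convex T (Q ∘ suc)

On-gmap : ∀ {n} (T : RTree n) p {Q : Pred (Fin (suc n)) 0ℓ} {i j} (w : Star (TreeAdj T) i j) →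
          Walks.On (graph T) (Q ∘ suc) w → Walks.On (graph (T ▸ p)) Q (Star.gmap suc id w)
On-gmap T p ε       q        = q
On-gmap T p (_ ◅ w) (q , on) = q , On-gmap T p w on

On-◅◅ : ∀ H {Q : Pred (Fin (Graph.order H)) 0ℓ} {i j k} (w : Star (Graph.Adj H) i j) (w′ : Star (Graph.Adj H) j k) →
        Walks.On H Q w → Walks.On H Q w′ → Walks.On H Q (w ◅◅ w′)
On-◅◅ H ε       w′ q        on′ = on′
On-◅◅ H (_ ◅ w) w′ (q , on) on′ = q , On-◅◅ H w w′ on on′

-- A walk between the newest leaf and an older vertex passes the parent of the leaf, and the first
-- half of `Convex` puts this parent into `Q`.
convex-walk : ∀ {n} (T : RTree n) {Q : Pred (Fin n) 0ℓ} → Convex T Q →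
              ∀ i j → Q i → Q j → Walks.On (graph T) Q (treeWalk T i j)
convex-walk root    c zero zero q q′ = q
convex-walk (T ▸ p) c zero zero q q′ = q
convex-walk (T ▸ p) (c , cs) zero (suc j) q q′ =
  q , On-gmap T p (treeWalk T p j) (convex-walk T cs p j (c j q q′) q′)
convex-walk (T ▸ p) (c , cs) (suc i) zero q q′ =
  On-◅◅ (graph (T ▸ p)) (Star.gmap suc id (treeWalk T i p)) _
    (On-gmap T p (treeWalk T i p) (convex-walk T cs i p q (c i q′ q))) (c i q′ q , q′)
convex-walk (T ▸ p) (c , cs) (suc i) (suc j) q q′ =
  On-gmap T p (treeWalk T i j) (convex-walk T cs i j q q′)

zero∉⇒map-suc : ∀ {n} (xs : List (Fin (suc n))) → zero ∉ˡ xs → ∃[ ys ] xs ≡ map suc ys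
zero∉⇒map-suc []           z∉ = [] , refl
zero∉⇒map-suc (zero ∷ xs)  z∉ = ⊥-elim (z∉ (here refl))
zero∉⇒map-suc (suc x ∷ xs) z∉ with zero∉⇒map-suc xs (z∉ ∘ there)
... | ys , refl = x ∷ ys , refl

last-map⁻ : ∀ {n} (ys : List (Fin n)) {v} → last (map suc ys) ≡ just v → ∃[ x ] (v ≡ suc x × last ys ≡ just x)
last-map⁻ (y ∷ [])     refl = y , refl , refl
last-map⁻ (_ ∷ y ∷ ys) e    = last-map⁻ (y ∷ ys) e

cycle-old : ∀ {n} (T : RTree n) p (C : Graph.Cycle (graph (T ▸ p))) →
            zero ∉ˡ Graph.vertices (Graph.Cycle.path C) → Graph.Cycle (graph T)
cycle-old T p record { path = record { vertices = xs ; starts = s ; ends = e ; linked = l ; simple = u }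
                     ; long = long ; closed = closed } z∉ with zero∉⇒map-suc xs z∉
cycle-old T p record { path = record { starts = () } } z∉ | [] , refl
... | ys@(_ ∷ _) , refl with s | last-map⁻ ys e
...   | refl | _ , refl , e′ = record
  { path   = record { vertices = ys ; starts = refl ; ends = e′ ; linked = Linked.map⁻ l ; simple = Unique.map⁻ u }
  ; long   = subst (3 ≤_) (length-map suc ys) long
  ; closed = closed }

-- The newest leaf has one neighbour and so lies on no cycle; hence every cycle already lives in the
-- smaller tree.
acyclic : ∀ {n} (T : RTree n) → ¬ Graph.Cycle (graph T)
acyclic root C with Graph.Cycle.path C | Graph.Cycle.long C
... | record { vertices = [] }          | ()
... | record { vertices = _ ∷ [] }      | s≤s ()
... | record { vertices = _ ∷ _ ∷ _ ; linked = () ∷ _ } | _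
acyclic (T ▸ p) C = acyclic T (cycle-old T p C (Walks.leaf∉cycle (graph (T ▸ p)) only C))
  where
  only : ∀ {x} → TreeAdj (T ▸ p) zero x → x ≡ suc p
  only {suc x} refl = refl

graph-isTree : ∀ {n} (T : RTree n) → Graph.IsTree (graph T)
graph-isTree T = record
  { nonEmpty  = nonEmpty T
  ; connected = λ i j → proj₁ (Walks.erase (graph T) (treeWalk T i j))
  ; acyclic   = acyclic T }
  where
  nonEmpty : ∀ {n} → RTree n → NonZero n
  nonEmpty root    = _
  nonEmpty (T ▸ p) = _

convex-path : ∀ {n} (T : RTree n) {Q : Pred (Fin n) 0ℓ} → Convex T Q → ∀ i j → Q i → Q j →
              All Q (Graph.vertices (Graph.IsTree.connected (graph-isTree T) i j))
convex-path T c i j q q′ = proj₂ (Walks.erase (graph T) (treeWalk T i j)) (convex-walk T c i j q q′)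

-- Pruning a finite tree, and the Helly property.

x∉p-x : ∀ {n} (p : Subset n) x → ¬ (x ∈ p - x)
x∉p-x (_ ∷ᵥ p) zero    ()
x∉p-x (_ ∷ᵥ p) (suc x) (there i) = x∉p-x p x i

∈-minus⁻ : ∀ {n} {p : Subset n} {x y} → x ∈ p → y ∈ p - x → y ∈ p × y ≢ x
∈-minus⁻ {p = p} {x} x∈ y∈ = proj₁ (x∈p⇒p-x⊂p x∈) y∈ , λ { refl → x∉p-x p x y∈ }

module Peeling (H : Graph) (noCycle : ¬ Graph.Cycle H) {m}
               (Bag : Graph.Vertex H → Fin m → Set) (Bag? : ∀ t e → Dec (Bag t e)) where
  open Graph H
  open Walks H

  -- The forgotten adjacency of t and t′ matters only through the condition on bags: an element of
  -- the bag of the leaf t that also occurs elsewhere lies in the bag of the neighbour t′.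
  data Peel (R : Subset order) : Set where
    single : ∀ t → (∀ {x} → x ∈ R → x ≡ t) → Peel R
    peel : ∀ t t′ → t′ ∈ R - t → t ∈ R →
           (∀ {e x} → x ∈ R - t → Bag t e → Bag x e → Bag t′ e) → Peel (R - t) → Peel R

  record Leaf (R : Subset order) : Set where
    constructor mkLeaf
    field
      {tip} stem : Vertex
      tip∈    : tip ∈ R
      stem∈   : stem ∈ R
      edge    : Adj tip stem
      only    : ∀ {x} → x ∈ R → Adj tip x → x ≡ stem

  -- A path that cannot be prolonged within R starts at a leaf of R, because another neighbour on the
  -- path would close a cycle. U contains all vertices off the path.
  extend : ∀ {R} fuel (U : Subset order) → ∣ U ∣ ≤ fuel → ∀ x y zs → Linked Adj (x ∷ y ∷ zs) → Unique (x ∷ y ∷ zs) →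
           All (_∈ R) (x ∷ y ∷ zs) → (∀ {w} → w ∉ˡ x ∷ y ∷ zs → w ∈ U) → Leaf R
  extend {R} fuel U U≤ x y zs l@(a ∷ l′) u@(x∉ ∷ y∉ ∷ _) r@(rx ∷ ry ∷ _) rest
    with any? (λ w → w ∈? R ×-dec adj? x w ×-dec ¬? (mem? _≟_ w (x ∷ y ∷ zs)))
  extend {R} zero U U≤ x y zs l u r rest | yes (w , w∈ , xw , w∉) with ≤-trans (x∈p⇒∣p-x∣<∣p∣ (rest w∉)) U≤
  ... | ()
  extend {R} (suc fuel) U U≤ x y zs l u r rest | yes (w , w∈ , xw , w∉) =
    extend fuel (U - w) (≤-pred (≤-trans (x∈p⇒∣p-x∣<∣p∣ (rest w∉)) U≤)) w x (y ∷ zs)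
      (adj-sym xw ∷ l) (¬Any⇒All¬ _ w∉ ∷ u) (w∈ ∷ r)
      λ v∉ → x∈p∧x≢y⇒x∈p-y (rest (v∉ ∘ there)) (v∉ ∘ here)
  extend {R} fuel U U≤ x y zs l@(a ∷ l′) u@(x∉ ∷ u′@(y∉ ∷ _)) (rx ∷ ry ∷ _) rest | no ∄ = mkLeaf y rx ry a only
    where
    only : ∀ {w} → w ∈ R → Adj x w → w ≡ y
    only {w} w∈ xw with mem? _≟_ w (x ∷ y ∷ zs)
    ... | no w∉               = ⊥-elim (∄ (w , w∈ , xw , w∉))
    ... | yes (here refl)     = ⊥-elim (adj-irrefl w xw)
    ... | yes (there (here e)) = e
    -- The stretch from `y` to `w`, preceded by `x`, has at least three vertices because `y ≢ w`;
    -- the edge between `w` and `x` closes it.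
    ... | yes (there w∈@(there w∈zs)) with prefix l′ u′ w∈
    ...   | q , q⊆ with cons a q (λ x∈ → All.lookup x∉ (q⊆ x∈) refl)
    ...     | c , eq = ⊥-elim (noCycle record
      { path = c ; long = subst (3 ≤_) (sym (cong length eq)) (s≤s (two≤length q (All.lookup y∉ w∈zs)))
      ; closed = adj-sym xw })
      where
      two≤length : ∀ {u v} (p : Path u v) → u ≢ v → 2 ≤ length (vertices p)
      two≤length record { vertices = [] ; starts = () } u≢v
      two≤length record { vertices = _ ∷ [] ; starts = refl ; ends = refl } u≢v = ⊥-elim (u≢v refl)
      two≤length record { vertices = _ ∷ _ ∷ _ } u≢v = s≤s (s≤s z≤n)

  first-step : ∀ {u v} {Q : Pred Vertex 0ℓ} (p : Path u v) → All Q (vertices p) → u ≢ v →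
               ∃[ w ] (Q w × Adj u w)
  first-step record { vertices = [] ; starts = () } q u≢v
  first-step record { vertices = _ ∷ [] ; starts = refl ; ends = refl } q u≢v = ⊥-elim (u≢v refl)
  first-step record { vertices = _ ∷ y ∷ _ ; starts = refl ; linked = a ∷ _ } (_ ∷ qy ∷ _) u≢v = y , qy , a

  -- The first step of a path inside `R` gives an edge, which is the two-vertex path that `extend`
  -- prolongs.
  findLeaf : ∀ {R} → ConnectedOn (_∈ R) → ∀ u v → u ∈ R → v ∈ R → u ≢ v → Leaf R
  findLeaf conn u v u∈ v∈ u≢v with conn u v u∈ v∈
  ... | p , p∈ with first-step p p∈ u≢v
  ...   | w , w∈ , a = extend order full (∣p∣≤n full) w u [] (adj-sym a ∷ [-])
                         (((λ { refl → adj-irrefl _ a }) ∷ []) ∷ [] ∷ []) (w∈ ∷ u∈ ∷ []) (λ _ → ∈⊤)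

  -- A path in `R` between two other vertices cannot pass through the tip, so the old connecting
  -- path still serves.
  connectedOn-minus : ∀ {R} (L : Leaf R) {P : Pred Vertex 0ℓ} → ConnectedOn (λ x → x ∈ R × P x) →
                      ConnectedOn (λ x → x ∈ R - Leaf.tip L × P x)
  connectedOn-minus (mkLeaf stem tip∈ _ _ only) conn u v (u∈ , pu) (v∈ , pv)
    with ∈-minus⁻ tip∈ u∈ | ∈-minus⁻ tip∈ v∈
  ... | u∈R , u≢t | v∈R , v≢t with conn u v (u∈R , pu) (v∈R , pv)
  ...   | p , all = p , All.zipWith (λ { ((x∈ , px) , x≢t) → x∈p∧x≢y⇒x∈p-y x∈ x≢t , px })
                          (all , avoids-path only p (All.map proj₁ all) u≢t v≢t)

  -- `fuel` bounds the size of `R`. The factor `⊤` puts the connectedness of `R` into the form that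
  -- `connectedOn-minus` preserves, as it does for the bags.
  peelable : ∀ fuel (R : Subset order) → ∣ R ∣ ≤ fuel → ∀ r → r ∈ R → ConnectedOn (λ x → x ∈ R × ⊤) →
             (∀ e → ConnectedOn (λ x → x ∈ R × Bag x e)) → Peel R
  peelable fuel R R≤ r r∈ conn bags with any? (λ x → x ∈? R ×-dec ¬? (r ≟ x))
  ... | no ∄ = single r λ {x} x∈ → sym (decidable-stable (r ≟ x) λ r≢x → ∄ (x , x∈ , r≢x))
  peelable zero R R≤ r r∈ conn bags | yes _ with ≤-trans (x∈p⇒∣p-x∣<∣p∣ r∈) R≤
  ... | ()
  peelable (suc fuel) R R≤ r r∈ conn bags | yes (v , v∈ , r≢v)
    with findLeaf (λ u v u∈ v∈ → map₂ (All.map proj₁) (conn u v (u∈ , tt) (v∈ , tt))) r v r∈ v∈ r≢v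
  ... | L@(mkLeaf {t} t′ t∈ t′∈ a only) = peel t t′ t′∈R-t t∈ toStem
          (peelable fuel (R - t) (≤-pred (≤-trans (x∈p⇒∣p-x∣<∣p∣ t∈) R≤)) t′ t′∈R-t
             (connectedOn-minus L conn) λ e → connectedOn-minus L (bags e))
    where
    t′∈R-t : t′ ∈ R - t
    t′∈R-t = x∈p∧x≢y⇒x∈p-y t′∈ λ { refl → adj-irrefl _ a }
    -- The path from `t` to `x` inside the subtree of `e` has to start with a step to the only
    -- neighbour of `t` in `R`.
    toStem : ∀ {e x} → x ∈ R - t → Bag t e → Bag x e → Bag t′ e
    toStem {e} {x} x∈ te xe with ∈-minus⁻ t∈ x∈
    ... | x∈R , x≢t with bags e t x (t∈ , te) (x∈R , xe)
    ...   | p , all with first-step p all (x≢t ∘ sym)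
    ...     | y , (y∈ , ye) , ty = subst (λ z → Bag z e) (only y∈ ty) ye

  -- The Helly property of subtrees.
  common : ∀ {R} → Peel R → (K : Pred (Fin m) 0ℓ) → Unary.Decidable K →
           (∀ {e f} → K e → K f → ∃[ x ] (x ∈ R × Bag x e × Bag x f)) →
           ∃[ t ] (∀ {e} → K e → Bag t e)
  common (single t only) K K? meet = t , λ {e} ke → let (x , x∈ , xe , _) = meet ke ke
                                                    in subst (λ z → Bag z e) (only x∈) xe
  common {R} (peel t t′ t′∈ t∈ toStem rest) K K? meet
    with any? (λ e → K? e ×-dec ¬? (any? λ x → x ∈? (R - t) ×-dec Bag? x e))
  -- This `e` occurs in `R` at no node but `t`, so every member of `K` meets it there.
  ... | yes (e , ke , ∄) = t , λ kf → atTip kf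
    where
    atTip : ∀ {f} → K f → Bag t f
    atTip {f} kf with meet ke kf
    ... | x , x∈ , xe , xf with x ≟ t
    ...   | yes refl = xf
    ...   | no x≢t   = ⊥-elim (∄ (x , x∈p∧x≢y⇒x∈p-y x∈ x≢t , xe))
  -- Every member of `K` now occurs away from `t`; those at `t` are therefore also at `t′`, and a
  -- meeting at `t` can be moved to `t′`.
  ... | no ∄ = common rest K K? λ ke kf → move ke kf (meet ke kf)
    where
    elsewhere : ∀ {e} → K e → Bag t e → Bag t′ e
    elsewhere {e} ke te with any? (λ x → x ∈? (R - t) ×-dec Bag? x e)
    ... | yes (x , x∈ , xe) = toStem x∈ te xe
    ... | no ∄x             = ⊥-elim (∄ (e , ke , ∄x))
    move : ∀ {e f} → K e → K f → ∃[ x ] (x ∈ R × Bag x e × Bag x f) → ∃[ x ] (x ∈ R - t × Bag x e × Bag x f)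
    move ke kf (x , x∈ , xe , xf) with x ≟ t
    ... | yes refl = t′ , t′∈ , elsewhere ke xe , elsewhere kf xf
    ... | no x≢t   = x , x∈p∧x≢y⇒x∈p-y x∈ x≢t , xe , xf

-- Merging two blocks of a partition.

-- The absorbing block `a` is numbered as after the deletion of `b`, which makes it distinct from
-- `b` by construction; its old number is `punchIn b a`.
merge : ∀ {k} → Fin (suc (suc k)) → Fin (suc k) → Fin (suc (suc k)) → Fin (suc k)
merge b a x with b ≟ x
... | yes _   = a
... | no b≢x  = punchOut b≢x

data View {k} (b : Fin (suc k)) : Fin (suc k) → Set where
  itself : View b b
  other  : ∀ y → View b (punchIn b y)

view : ∀ {k} (b x : Fin (suc k)) → View b x
view b x with b ≟ x
... | yes refl = itself
... | no b≢x   = subst (View b) (punchIn-punchOut b≢x) (other (punchOut b≢x))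

module _ {k} (b : Fin (suc (suc k))) (a : Fin (suc k)) where

  merge-itself : merge b a b ≡ a
  merge-itself with b ≟ b
  ... | yes _  = refl
  ... | no b≢b = ⊥-elim (b≢b refl)

  merge-other : ∀ y → merge b a (punchIn b y) ≡ y
  merge-other y with b ≟ punchIn b y
  ... | yes b≡ = ⊥-elim (punchInᵢ≢i b y (sym b≡))
  ... | no b≢  = trans (punchOut-cong b refl) (punchOut-punchIn b)

  merge⁻ : ∀ {x y} → merge b a x ≡ y → (x ≡ b × y ≡ a) ⊎ x ≡ punchIn b y
  merge⁻ {x} eq with view b x
  ... | itself  = inj₁ (refl , trans (sym eq) merge-itself)
  ... | other z = inj₂ (cong (punchIn b) (trans (sym (merge-other z)) eq))

-- Mergeable partitions and their layouts on trees.

module Merging (G : Graph) where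
  open Graph G hiding (degree)

  src tgt : Edge → Vertex
  src = proj₁ ∘ endpoints
  tgt = proj₂ ∘ endpoints

  module _ {k} (f : Vertex → Fin k) where

    Cross : Pred Edge 0ℓ
    Cross e = f (src e) ≢ f (tgt e)

    Incident : Fin k → Pred Edge 0ℓ
    Incident i e = f (src e) ≡ i ⊎ f (tgt e) ≡ i

    -- Edges joining the two blocks count as well, since `Cross` refers to the partition before the
    -- merge. With `i` and `j` equal these are the edges leaving one block.
    Leaving : Fin k → Fin k → Pred Edge 0ℓ
    Leaving i j e = Cross e × (Incident i e ⊎ Incident j e)

    incident? : ∀ i → Unary.Decidable (Incident i)
    incident? i e = (f (src e) ≟ i) ⊎-dec (f (tgt e) ≟ i)

    leaving? : ∀ i j → Unary.Decidable (Leaving i j)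
    leaving? i j e = ¬? (f (src e) ≟ f (tgt e)) ×-dec (incident? i e ⊎-dec incident? j e)

  -- The partition of the vertices into the fibres of f can be merged pairwise into a single
  -- block, with at most c edges leaving one of the two blocks that are merged.
  Mergeable : ℕ → ∀ {k} → (Vertex → Fin (suc k)) → Set
  Mergeable c {zero}  f = ⊤
  Mergeable c {suc k} f = ∃₂ λ b a →
    count (leaving? f (punchIn b a) b) ≤ c × Mergeable c (merge b a ∘ f)

  mergeable? : ∀ c {k} (f : Vertex → Fin (suc k)) → Dec (Mergeable c f)
  mergeable? c {zero}  f = yes tt
  mergeable? c {suc k} f = any? λ b → any? λ a →
    (count (leaving? f (punchIn b a) b) ≤? c) ×-dec mergeable? c (merge b a ∘ f)

  -- No merge can involve more than all edges, so any order of merges will do. This starts the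
  -- search for the least bound.
  mergeable-max : ∀ {k} (f : Vertex → Fin (suc k)) → Mergeable (length edges) f
  mergeable-max {zero}  f = tt
  mergeable-max {suc k} f = zero , zero , ∣p∣≤n (tabulate _) , mergeable-max (merge zero zero ∘ f)

  -- An embedding of the quotient by f: the block i sits at the leaf loc i, and Bag x contains
  -- the edges whose path passes through x.
  record Layout (c : ℕ) {k} (f : Vertex → Fin (suc k)) : Set₁ where
    field
      {size}   : ℕ
      tree     : RTree size
      subcubic : ∀ x → degree tree x ≤ 3
      loc      : Fin (suc k) → Fin size
      loc-inj  : ∀ {i j} → loc i ≡ loc j → i ≡ j
      loc-leaf : ∀ i → degree tree (loc i) ≡ 1
      Bag      : Fin size → Pred Edge 0ℓ
      bag?     : ∀ x → Unary.Decidable (Bag x)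
      thin     : ∀ x → count (bag? x) ≤ c
      convex   : ∀ e → Convex tree (λ x → Bag x e)
      at-ends  : ∀ {i e} → Cross f e → Incident f i e → Bag (loc i) e
      crossing : ∀ {x e} → Bag x e → Cross f e

  -- Two nodes, because the single block must sit at a node of degree exactly 1. No edge crosses, so
  -- empty bags suffice.
  trivialLayout : ∀ c (f : Vertex → Fin 1) → Layout c f
  trivialLayout c f = record
    { tree     = root ▸ zero
    ; subcubic = λ { zero → s≤s z≤n ; (suc zero) → s≤s z≤n }
    ; loc      = λ _ → zero
    ; loc-inj  = λ { {zero} {zero} _ → refl }
    ; loc-leaf = λ _ → refl
    ; Bag      = λ _ _ → ⊥
    ; bag?     = λ _ _ → no λ ()
    ; thin     = λ _ → ≤-trans (≤-reflexive (∣outside∣ (length edges))) z≤n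
    ; convex   = λ _ → (λ _ ()) , tt
    ; at-ends  = λ {_} {e} f≢ _ → ⊥-elim (f≢ (only-zero (f (src e)) (f (tgt e))))
    ; crossing = λ () }
    where
    only-zero : ∀ (i j : Fin 1) → i ≡ j
    only-zero zero zero = refl

  module Split {c k} {f : Vertex → Fin (suc (suc k))} (b : Fin (suc (suc k))) (a : Fin (suc k))
               (few : count (leaving? f (punchIn b a) b) ≤ c) (L : Layout c (merge b a ∘ f)) where
    open Layout L

    a⁺ = punchIn b a

    -- Below the leaf of the merged block come a vertex (number 2) and its two children for a⁺ and b.
    tree₁ = tree ▸ loc a
    tree₂ = tree₁ ▸ zero
    tree₃ = tree₂ ▸ suc zero

    data Place : Fin (suc (suc k)) → Set where
      at-b  : Place b
      at-a  : Place a⁺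
      apart : ∀ {y} → y ≢ a → Place (punchIn b y)

    place : ∀ i → Place i
    place i with view b i
    ... | itself = at-b
    ... | other y with y ≟ a
    ...   | yes refl = at-a
    ...   | no y≢a   = apart y≢a

    node : ∀ {i} → Place i → Fin (suc (suc (suc size)))
    node at-b            = zero
    node at-a            = suc zero
    node (apart {y} y≢a) = suc (suc (suc (loc y)))

    node-inj : ∀ {i j} (p : Place i) (q : Place j) → node p ≡ node q → i ≡ j
    node-inj at-b      at-b      eq = refl
    node-inj at-a      at-a      eq = refl
    node-inj (apart _) (apart _) eq =
      cong (punchIn b) (loc-inj (suc-injective (suc-injective (suc-injective eq))))

    degree-attach : ∀ x → degree tree₃ (suc (suc (suc x))) ≡ degree tree₁ (suc x)
    degree-attach x = trans (degree-old tree₂ (suc zero) (suc (suc x)) λ ()) (degree-old tree₁ zero (suc x) λ ())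

    degree-stem : degree tree₃ (suc (suc zero)) ≡ 3
    degree-stem = trans (degree-parent tree₂ (suc zero))
                        (cong suc (trans (degree-parent tree₁ zero) (cong suc (degree-new tree (loc a)))))

    node-leaf : ∀ {i} (p : Place i) → degree tree₃ (node p) ≡ 1
    node-leaf at-b        = degree-new tree₂ (suc zero)
    node-leaf at-a        = trans (degree-old tree₂ (suc zero) zero λ ()) (degree-new tree₁ zero)
    node-leaf (apart y≢a) = trans (degree-attach _)
      (trans (degree-old tree (loc a) _ (y≢a ∘ sym ∘ loc-inj)) (loc-leaf _))

    subcubic₃ : ∀ x → degree tree₃ x ≤ 3
    subcubic₃ zero             = ≤-trans (≤-reflexive (node-leaf at-b)) (s≤s z≤n)
    subcubic₃ (suc zero)       = ≤-trans (≤-reflexive (node-leaf at-a)) (s≤s z≤n)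
    subcubic₃ (suc (suc zero)) = ≤-reflexive degree-stem
    subcubic₃ (suc (suc (suc x))) = subst (_≤ 3) (sym (degree-attach x)) (bound (loc a ≟ x))
      where
      bound : Dec (loc a ≡ x) → degree tree₁ (suc x) ≤ 3
      bound (no ≢x)    = ≤-trans (≤-reflexive (degree-old tree (loc a) x ≢x)) (subcubic x)
      -- The former leaf `loc a` becomes an inner vertex of degree 2.
      bound (yes refl) = ≤-trans (≤-reflexive (trans (degree-parent tree x) (cong suc (loc-leaf a)))) (s≤s (s≤s z≤n))

    -- The branching vertex carries exactly the edges counted by `few`. Old bags stay as they are:
    -- an edge joining `a⁺` and `b` does not cross the merged partition and appears in the three new
    -- bags alone.
    Bag₃ : Fin (suc (suc (suc size))) → Pred Edge 0ℓ
    Bag₃ zero                = Leaving f b b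
    Bag₃ (suc zero)          = Leaving f a⁺ a⁺
    Bag₃ (suc (suc zero))    = Leaving f a⁺ b
    Bag₃ (suc (suc (suc x))) = Bag x

    bag₃? : ∀ x → Unary.Decidable (Bag₃ x)
    bag₃? zero                = leaving? f b b
    bag₃? (suc zero)          = leaving? f a⁺ a⁺
    bag₃? (suc (suc zero))    = leaving? f a⁺ b
    bag₃? (suc (suc (suc x))) = bag? x

    from-b : ∀ {e} → Leaving f b b e → Leaving f a⁺ b e
    from-b (cross , inc) = cross , inj₂ ([ id , id ]′ inc)

    from-a : ∀ {e} → Leaving f a⁺ a⁺ e → Leaving f a⁺ b e
    from-a (cross , inc) = cross , inj₁ ([ id , id ]′ inc)

    thin₃ : ∀ x → count (bag₃? x) ≤ c
    thin₃ zero                = ≤-trans (count-mono (leaving? f b b) (leaving? f a⁺ b) from-b) few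
    thin₃ (suc zero)          = ≤-trans (count-mono (leaving? f a⁺ a⁺) (leaving? f a⁺ b) from-a) few
    thin₃ (suc (suc zero))    = few
    thin₃ (suc (suc (suc x))) = thin x

    incident-merge : ∀ {i y e} → merge b a i ≡ y → Incident f i e → Incident (merge b a ∘ f) y e
    incident-merge eq (inj₁ s) = inj₁ (trans (cong (merge b a) s) eq)
    incident-merge eq (inj₂ t) = inj₂ (trans (cong (merge b a) t) eq)

    convex₃ : ∀ e → Convex tree₃ (λ x → Bag₃ x e)
    convex₃ e = (λ _ be _ → from-b be) , (λ _ ae _ → from-a ae) , old , convex e
      where
      -- An edge in an old bag crosses the merged partition; touching `a⁺` or `b`, it touches the
      -- merged block and hence lies in the bag at its leaf.
      old : ∀ x → Leaving f a⁺ b e → Bag x e → Bag (loc a) e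
      old x (_ , inj₁ inc) xe = at-ends (crossing xe) (incident-merge (merge-other b a a) inc)
      old x (_ , inj₂ inc) xe = at-ends (crossing xe) (incident-merge (merge-itself b a) inc)

    at-ends₃ : ∀ {i e} (p : Place i) → Cross f e → Incident f i e → Bag₃ (node p) e
    at-ends₃ at-b cross inc = cross , inj₁ inc
    at-ends₃ at-a cross inc = cross , inj₁ inc
    at-ends₃ {e = e} (apart {y} y≢a) cross inc = at-ends cross′ inc′
      where
      inc′ : Incident (merge b a ∘ f) y e
      inc′ = incident-merge (merge-other b a y) inc
      source : ∀ {x} → merge b a x ≡ y → x ≡ punchIn b y
      source eq with merge⁻ b a eq
      ... | inj₁ (_ , y≡a) = ⊥-elim (y≢a y≡a)
      ... | inj₂ x≡        = x≡
      -- If the merge identified the two ends, both would lie in `y`; as `y ≢ a`, they would have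
      -- shared the block `punchIn b y` before.
      cross′ : Cross (merge b a ∘ f) e
      cross′ eq with inc′
      ... | inj₁ s = cross (trans (source s) (sym (source (trans (sym eq) s))))
      ... | inj₂ t = cross (trans (source (trans eq t)) (sym (source t)))

    crossing₃ : ∀ x {e} → Bag₃ x e → Cross f e
    crossing₃ zero                = proj₁
    crossing₃ (suc zero)          = proj₁
    crossing₃ (suc (suc zero))    = proj₁
    crossing₃ (suc (suc (suc x))) xe = crossing xe ∘ cong (merge b a)

    split : Layout c f
    split = record
      { tree     = tree₃
      ; subcubic = subcubic₃
      ; loc      = node ∘ place
      ; loc-inj  = node-inj (place _) (place _)
      ; loc-leaf = node-leaf ∘ place
      ; Bag      = Bag₃
      ; bag?     = bag₃?
      ; thin     = thin₃
      ; convex   = convex₃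
      ; at-ends  = at-ends₃ (place _)
      ; crossing = λ {x} → crossing₃ x }

  layout : ∀ {c k} (f : Vertex → Fin (suc k)) → Mergeable c f → Layout c f
  layout {c} {zero}  f _                   = trivialLayout c f
  layout {c} {suc k} f (b , a , few , rest) = Split.split b a few (layout (merge b a ∘ f) rest)

  src≢tgt : ∀ e → src e ≢ tgt e
  src≢tgt e src≡tgt = <-irrefl src≡tgt
    (proj₁ (proj₂ (∈-filter⁻ (λ (u , v) → (u <? v) ×-dec adj? u v)
      {xs = cartesianProduct (allFin order) (allFin order)} (∈-lookup {xs = edges} e))))

-- From layouts to embeddings to decompositions and back to merges.

record Enumeration (n : ℕ) : Set where
  field
    {pred} : ℕ
    to     : Fin n → Fin (suc pred)
    from   : Fin (suc pred) → Fin n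
    from∘to : ∀ i → from (to i) ≡ i

-- `Mergeable` speaks of a visibly nonempty `Fin (suc k)`; here the hypothesis that `G` has a vertex
-- supplies one for the partition into singletons.
enumeration : ∀ n → NonZero n → Enumeration n
enumeration (suc n) _ = record { to = id ; from = id ; from∘to = λ _ → refl }

module Congestion (G : Graph) (nonZero : NonZero (Graph.order G)) where
  open Graph G hiding (degree)
  open Merging G
  open Enumeration (enumeration order nonZero)

  to-injective : ∀ {u v} → to u ≡ to v → u ≡ v
  to-injective eq = trans (sym (from∘to _)) (trans (cong from eq) (from∘to _))

  module _ {c} (L : Layout c to) where
    open Layout L

    embedding : Embedding G
    embedding = record
      { tree = graph tree ; isTree = graph-isTree tree ; subcubic = subcubic ; π = loc ∘ to
      ; injective = to-injective ∘ loc-inj ; leaf = loc-leaf ∘ to }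

    -- The bags containing an edge form a subtree that includes the leaves of both its ends, so the
    -- path between them stays in that subtree.
    embedding-congestion : Embedding.congestion embedding ≤ c
    embedding-congestion = max-least _ λ u →
      ≤-trans (count-mono (λ e → mem? _≟_ u (Embedding.pathVertices embedding e)) (bag? u) λ {e} → All.lookup (inBag e)) (thin u)
      where
      inBag : ∀ e → All (λ x → Bag x e) (Embedding.pathVertices embedding e)
      inBag e = convex-path tree (convex e) _ _ (at-ends cross (inj₁ refl)) (at-ends cross (inj₂ refl))
        where
        cross : Cross to e
        cross = src≢tgt e ∘ to-injective

  module _ (E : Embedding G) where
    open Embedding E

    onPath? : ∀ u → Unary.Decidable (λ e → u ∈ˡ pathVertices e)
    onPath? u e = mem? _≟_ u (pathVertices e)

    pathBag : Graph.Vertex tree → Subset (length edges)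
    pathBag u = tabulate (does ∘ onPath? u)

    src-bag : ∀ e → e ∈ pathBag (π (src e))
    src-bag e = ∈-tabulate⁺ (onPath? _) (Walks.path-nonEmpty tree (Graph.IsTree.connected isTree _ _))

    tgt-bag : ∀ e → e ∈ pathBag (π (tgt e))
    tgt-bag e = ∈-tabulate⁺ (onPath? _) (Walks.path-end∈ tree (Graph.IsTree.connected isTree _ _))

    -- Edges with a common end `v` share the bag at `π v`. Bag sizes are by definition the counts in
    -- the congestion, so the width is the congestion minus 1 on the nose.
    decomposition : TreeDecomposition (lineGraph G)
    decomposition = record
      { tree      = tree
      ; isTree    = isTree
      ; bag       = pathBag
      ; covers    = λ e → _ , src-bag e
      ; connected = connectedOn
      ; edgeInBag = λ (_ , share) → meet share }
      where
      connectedOn : ∀ e → Graph.ConnectedOn tree (λ u → e ∈ pathBag u)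
      connectedOn e u v u∈ v∈ with Walks.path-connectedOn tree (Graph.IsTree.connected isTree (π (src e)) (π (tgt e)))
                                     u v (∈-tabulate⁻ (onPath? u) u∈) (∈-tabulate⁻ (onPath? v) v∈)
      ... | p , p∈ = p , All.map (λ {x} → ∈-tabulate⁺ (onPath? x)) p∈
      meet : ∀ {e f} → ShareEndpoint G e f → ∃[ u ] (e ∈ pathBag u × f ∈ pathBag u)
      meet {e} {f} (inj₁ (inj₁ eq)) = _ , src-bag e , subst (λ v → f ∈ pathBag (π v)) (sym eq) (src-bag f)
      meet {e} {f} (inj₁ (inj₂ eq)) = _ , tgt-bag e , subst (λ v → f ∈ pathBag (π v)) (sym eq) (tgt-bag f)
      meet {e} {f} (inj₂ (inj₁ eq)) = _ , src-bag e , subst (λ v → f ∈ pathBag (π v)) (sym eq) (tgt-bag f)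
      meet {e} {f} (inj₂ (inj₂ eq)) = _ , tgt-bag e , subst (λ v → f ∈ pathBag (π v)) (sym eq) (src-bag f)

  module _ (D : TreeDecomposition (lineGraph G)) where
    open TreeDecomposition D using (tree; bag; covers; edgeInBag) renaming (isTree to treeIsTree; connected to bag-connected)
    open Peeling tree (Graph.IsTree.acyclic treeIsTree) (λ t e → e ∈ bag t) (λ t e → e ∈? bag t)

    node₀ : ∀ n → NonZero n → Fin n
    node₀ (suc n) _ = zero

    peeling : Peel full
    peeling = peelable (Graph.order tree) full (∣p∣≤n full) (node₀ _ (Graph.IsTree.nonEmpty treeIsTree)) ∈⊤
      (λ u v _ _ → Graph.IsTree.connected treeIsTree u v , All.tabulate (λ _ → ∈⊤ , tt))
      λ e u v (_ , ue) (_ , ve) → map₂ (All.map (∈⊤ ,_)) (bag-connected e u v ue ve)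

    homes : ∀ v → ∃[ t ] (∀ {e} → Incident id v e → e ∈ bag t)
    homes v = common peeling (Incident id v) (incident? id v) meet
      where
      share : ∀ {e f} → Incident id v e → Incident id v f → ShareEndpoint G e f
      share (inj₁ p) (inj₁ q) = inj₁ (inj₁ (trans p (sym q)))
      share (inj₁ p) (inj₂ q) = inj₂ (inj₁ (trans p (sym q)))
      share (inj₂ p) (inj₁ q) = inj₂ (inj₂ (trans p (sym q)))
      share (inj₂ p) (inj₂ q) = inj₁ (inj₂ (trans p (sym q)))
      meet : ∀ {e f} → Incident id v e → Incident id v f → ∃[ x ] (x ∈ full × e ∈ bag x × f ∈ bag x)
      meet {e} {f} p q with e ≟ f
      -- An edge is not adjacent to itself in the line graph, so here the common bag comes from
      -- `covers`.
      ... | yes refl = let (x , xe) = covers e in x , ∈⊤ , xe , xe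
      ... | no e≢f   = let (x , xe , xf) = edgeInBag (e≢f , share {e} {f} p q) in x , ∈⊤ , xe , xf

    width⁺ : ℕ
    width⁺ = max (λ t → ∣ bag t ∣)

    -- Blocks at a common node are merged; once no two blocks share a node, a leaf is removed
    -- and the block there, if any, moves to its neighbour.
    sweep : ∀ {R} → Peel R → ∀ {k} (f : Vertex → Fin (suc k)) (pos : Fin (suc k) → Graph.Vertex tree) →
            (∀ i → pos i ∈ R) → (∀ {i e} → Cross f e → Incident f i e → e ∈ bag (pos i)) → Mergeable width⁺ f
    sweep P {zero}  f pos pos∈ inBag = tt
    sweep P {suc k} f pos pos∈ inBag with any? (λ b → any? (λ a → pos b ≟ pos (punchIn b a)))
    -- All edges leaving either of the two blocks lie in the bag of their common node, whose size
    -- bounds the cost of the merge.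
    ... | yes (b , a , eq) = b , a
        , ≤-trans (count≤∣_∣ (leaving? f (punchIn b a) b) (bag (pos b)) λ
            { (cross , inj₁ inc) → subst (λ t → _ ∈ bag t) (sym eq) (inBag cross inc)
            ; (cross , inj₂ inc) → inBag cross inc }) (max-upper (λ t → ∣ bag t ∣) (pos b))
        , sweep P (merge b a ∘ f) (pos ∘ punchIn b) (pos∈ ∘ punchIn b) inBag′
      where
      inBag′ : ∀ {i e} → Cross (merge b a ∘ f) e → Incident (merge b a ∘ f) i e → e ∈ bag (pos (punchIn b i))
      inBag′ {i} {e} cross′ inc′ = [ source inj₁ , source inj₂ ]′ inc′
        where
        cross : Cross f e
        cross = cross′ ∘ cong (merge b a)
        source : ∀ {x} → (∀ {j} → x ≡ j → Incident f j e) → merge b a x ≡ i → e ∈ bag (pos (punchIn b i))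
        source inc eq′ with merge⁻ b a eq′
        -- An edge inherited from `b` lies in the bag at the node of `b`, which is also the node of
        -- the surviving block.
        ... | inj₁ (x≡b , refl) = subst (λ t → e ∈ bag t) eq (inBag cross (inc x≡b))
        ... | inj₂ x≡           = inBag cross (inc x≡)
    sweep (single t only) {suc k} f pos pos∈ inBag | no apart =
      ⊥-elim (apart (zero , zero , trans (only (pos∈ zero)) (sym (only (pos∈ (suc zero))))))
    sweep (peel t t′ t′∈ t∈ toStem rest) {suc k} f pos pos∈ inBag | no apart =
      -- Merges lower `k` and removals shrink the peeling, so the recursion ends.
      sweep rest f (move ∘ pos) move∈ moved
      where
      move : Graph.Vertex tree → Graph.Vertex tree
      move x with x ≟ t
      ... | yes _ = t′
      ... | no _  = x
      pos-inj : ∀ {i j} → i ≢ j → pos i ≢ pos j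
      pos-inj {i} i≢j eq = apart (i , punchOut i≢j , trans eq (sym (cong pos (punchIn-punchOut i≢j))))
      move∈ : ∀ i → move (pos i) ∈ _ - t
      move∈ i with pos i ≟ t
      ... | yes _ = t′∈
      ... | no ≢t = x∈p∧x≢y⇒x∈p-y (pos∈ i) ≢t
      moved : ∀ {i e} → Cross f e → Incident f i e → e ∈ bag (move (pos i))
      moved {i} {e} cross inc with pos i ≟ t
      ... | no _    = inBag cross inc
      ... | yes i↦t = [ (λ s → fromOther (inj₂ refl) λ i≡ → cross (trans s i≡))
                      , (λ g → fromOther (inj₁ refl) λ i≡ → cross (trans (sym i≡) (sym g))) ]′ inc
        where
        -- The other end of `e` lies in a block `j` at another node, so `e` occurs in a bag away
        -- from `t` too, and `toStem` carries it to `t′`.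
        fromOther : ∀ {j} → Incident f j e → i ≢ j → e ∈ bag t′
        fromOther {j} incⱼ i≢j = toStem
          (x∈p∧x≢y⇒x∈p-y (pos∈ j) λ j↦t → pos-inj i≢j (trans i↦t (sym j↦t)))
          (subst (λ x → e ∈ bag x) i↦t (inBag cross inc)) (inBag cross incⱼ)

    mergeable : Mergeable width⁺ to
    mergeable = sweep peeling to (λ i → proj₁ (homes (from i))) (λ _ → ∈⊤)
      λ {i} _ inc → proj₂ (homes (from i)) (back inc)
      where
      back : ∀ {i e} → Incident to i e → Incident id (from i) e
      back (inj₁ s) = inj₁ (trans (sym (from∘to _)) (cong from s))
      back (inj₂ t) = inj₂ (trans (sym (from∘to _)) (cong from t))

  -- Every decomposition, and through `decomposition` every embedding, yields merges within its own
  -- bound, so the least `c` is a lower bound for both. The embedding built from optimal merges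
  -- attains it, and its decomposition has width `c` minus 1.
  congestion≡treewidth+1 : ∃₂ λ c t → VertexCongestion G c × Treewidth (lineGraph G) t × + c ≡ t + 1ℤ
  congestion≡treewidth+1 with least (λ c → mergeable? c to) (mergeable-max to)
  ... | c , mc , c≤ = c , + c ℤ.- 1ℤ , ((E , E≡c) , λ E′ → c≤ (mergeable (decomposition E′)))
      , ((decomposition E , cong (λ n → + n ℤ.- 1ℤ) E≡c)
        , λ D → ℤₚ.+-monoˡ-≤ (ℤ.- 1ℤ) (ℤ.+≤+ (c≤ (mergeable D))))
      , sym (trans (ℤₚ.+-assoc (+ c) (ℤ.- 1ℤ) 1ℤ) (ℤₚ.+-identityʳ (+ c)))
    where
    L : Layout c to
    L = layout to mc
    E : Embedding G
    E = embedding L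
    E≡c : Embedding.congestion E ≡ c
    E≡c = ≤-antisym (embedding-congestion L) (c≤ (mergeable (decomposition E)))

theorem2p4 : (G : Graph) → NonZero (Graph.order G) →
    ∃₂ λ c t → VertexCongestion G c × Treewidth (lineGraph G) t × + c ≡ t + 1ℤ
theorem2p4 G nonZero = Congestion.congestion≡treewidth+1 G nonZero
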